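{- Let $B$ be a bigraph under a signature $\Sigma=(K,arity)$. Then $\big[\!\big[\,[\![B]\!]\,\big]\!\big]^{\star}\bumpeq B$.
   Context: **Bigraphs.** A signature is $\Sigma=(K,arity)$ with $K$ a set of controls and $arity:K\to\mathbb N$. A bigraph under $\Sigma$ is $B=(V_B,E_B,P_B,ctrl_B,prnt_B,link_B):\langle m,X\rangle\to\langle n,Y\rangle$, where $m,n$ are finite ordinals (the sites, resp. roots), $X,Y,V_B,E_B$ are finite sets (inner names, outer names, nodes, edges), $ctrl_B:V_B\to K$, $P_B=\{(v,i)\mid v\in V_B,\ i\in arity(ctrl_B\,v)\}$ (ports; a natural number is the set of smaller numbers), $prnt_B:V_B\cup m\to V_B\cup n$ is total and establishes a tree-shaped (acyclic) parent ordering on the nodes, and $link_B:X\cup P_B\to E_B\cup Y$ is total. The sets $m,n,X,Y,V_B,E_B$ are assumed disjoint. **Lean equivalence.** Two bigraphs $B,G$ with the same interfaces $\langle k,X\rangle\to\langle m,Y\rangle$ satisfy $B\bumpeq G$ if there are bijections $\rho_V:V_B\to V_G$ and $\rho_E:E_B\to E_G$ with $ctrl_G\circ\rho_V=ctrl_B$ (so that $\rho_P:P_B\to P_G$, $\rho_P(v,i)=(\rho_V\,v,i)$, is a bijection), $prnt_G\circ(Id_k\uplus\rho_V)=(Id_m\uplus\rho_V)\circ prnt_B$ and $link_G\circ(Id_X\uplus\rho_P)=(Id_Y\uplus\rho_E)\circ link_B$. **Relation symbols.** Facts are built from names of the disjoint sorts node, root, site, port, o_name, i_name, e_name, and from controls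 and natural numbers. Destinations in the place graph are dst_n $a$ ($a$ a node), dst_r $r$ ($r$ a root); sources are src_n $a$, src_s $s$ ($s$ a site). In the link graph destinations are dst_o $o$ ($o$ an outer name), dst_e $e$ ($e$ an edge), sources are src_i $i$ ($i$ an inner name), src_p $p$ ($p$ a port). The facts are is_root $r$, is_node $a$, is_site $s$, is_port $p$, is_o_name $o$, is_i_name $i$, is_e_name $e$, prnt $S\,D$, link $S\,D$ ($S$ a source, $D$ a destination), lc $a\,k$ (node $a$ has control $k$), lp $p\,a$ (port $p$ belongs to node $a$), has_child_p $D\,N$, has_child_l $D\,N$ ($N$ a natural number). **Encoding.** Names are chosen injectively for the nodes, edges, ports, roots, sites, inner and outer names of $B$ (the names of different sorts being distinct); an element and its name are written alike, and for a name $t$ the element it stands for is written $|t|$. $[\![B]\!]$ is the multi-set in which each of the following occurs exactly once: is_root $r$, has_child_p (dst_r $r$) $|prnt_B^{ -1}(r)|$ for each root $r\in n$; is_node $v$, lc $v$ $(ctrl_B\,v)$, has_child_p (dst_n $v$) $|prnt_B^{ -1}(v)|$, prnt (src_n $v$) $(prnt_B\,v)$ for each $v\in V_B$; is_site $s$, prnt (src_s $s$) $(prnt_B\,s)$ for each site $s\in m$; is_port $p$, lp $p\,v$, link (src_p $p$) $(link_B\,p)$ for each port $p=(v,i)\in P_B$; is_o_name $o$, has_child_l (dst_o $o$) $|link_B^{ -1}(o)|$ for each $o\in Y$; is_e_name $e$, has_child_l (dst_e $e$) $|link_B^{ -1}(e)|$ for each $e\in E_B$; is_i_name $x$, link (src_i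 $x$) $(link_B\,x)$ for each $x\in X$. Here values of $prnt_B$ and $link_B$ carry the appropriate constructor dst_n, dst_r, dst_o, dst_e. **Interpretation.** For a multi-set $S$ that encodes a bigraph, $[\![S]\!]^\star$ is the bigraph read off from $S$: its nodes, edges, ports, roots, sites, outer names and inner names are the (elements denoted by the) names $t$ with, respectively, is_node $t$, is_e_name $t$, is_port $t$, is_root $t$, is_site $t$, is_o_name $t$, is_i_name $t$ in $S$; ports $p$ with lp $p\,v\in S$ are the ports of $v$; and $ctrl\,v=k$ iff lc $v\,k\in S$, $prnt\,x=y$ iff prnt $x\,y\in S$, $link\,x=y$ iff link $x\,y\in S$ (constructors src, dst dropped). -}

module Defs where

open import Data.Fin.Base using (Fin; toℕ; cast)
import Data.Fin.Properties as Fin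
open import Data.List.Base using (List; []; _∷_; _++_; map; concatMap; filter; length; tabulate; allFin)
open import Data.List.Membership.Propositional using (_∈_)
open import Data.Nat.Base using (ℕ; _<_)
open import Data.Product using (Σ; Σ-syntax; ∃; ∃₂; ∃!; _×_; _,_; proj₁; proj₂)
open import Data.Refinement using (Refinement-syntax; value)
open import Data.Sum.Base as Sum using (_⊎_; inj₁; inj₂)
import Data.Sum.Properties as Sum
open import Data.Sum.Relation.Binary.Pointwise using (Pointwise)
open import Function.Base using (id; _∘_)
open import Function.Bundles using (_↔_; _↣_; _⤖_; _⇔_; Inverse; Injection; Bijection)
open import Function.Properties.Inverse using (↔⇒↣)
open import Relation.Binary.Construct.Closure.Transitive using (TransClosure)
open import Relation.Binary.Definitions using (DecidableEquality)
open import Relation.Binary.PropositionalEquality using (_≡_; refl; sym; trans; cong)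
open import Relation.Nullary.Decidable using (via-injection)
open import Relation.Nullary.Negation using (¬_)

record FiniteSet : Set₁ where
  field
    Carrier : Set
    size    : ℕ
    enum    : Carrier ↔ Fin size

  elements : List Carrier
  elements = tabulate (Inverse.from enum)

  _≟_ : DecidableEquality Carrier
  _≟_ = via-injection (↔⇒↣ enum) Fin._≟_

open FiniteSet using (Carrier; elements)

record Signature : Set₁ where
  field
    Control : Set
    arity   : Control → ℕ

open Signature

record Interface : Set₁ where
  constructor ⟨_,_⟩
  field
    width : ℕ
    names : FiniteSet

  LinkName : Set
  LinkName = Carrier names

open Interface

Acyclic : {V M N : Set} → (V ⊎ M → V ⊎ N) → Set
Acyclic prnt = ∀ v → ¬ TransClosure (λ u w → prnt (inj₁ u) ≡ inj₁ w) v v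

-- Unions of the pairwise disjoint sets m, n, X, Y, V, E are disjoint sums.
record Bigraph (Sg : Signature) (I J : Interface) : Set₁ where
  field
    nodes edges : FiniteSet

  Node : Set
  Node = Carrier nodes

  Edge : Set
  Edge = Carrier edges

  field
    ctrl : Node → Control Sg

  Port : Set
  Port = Σ[ v ∈ Node ] Fin (arity Sg (ctrl v))

  field
    prnt    : Node ⊎ Fin (width I) → Node ⊎ Fin (width J)
    acyclic : Acyclic prnt
    link    : LinkName I ⊎ Port → Edge ⊎ LinkName J

module _ {Sg : Signature} {I J : Interface} where

  infix 4 _≎_

  record _≎_ (B G : Bigraph Sg I J) : Set where
    private
      module B = Bigraph B
      module G = Bigraph G
    field
      ρV : B.Node ⤖ G.Node
      ρE : B.Edge ⤖ G.Edge

    ρv : B.Node → G.Node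
    ρv = Bijection.to ρV

    ρe : B.Edge → G.Edge
    ρe = Bijection.to ρE

    field
      ctrl-≡ : ∀ v → G.ctrl (ρv v) ≡ B.ctrl v

    ρp : B.Port → G.Port
    ρp (v , i) = ρv v , cast (cong (arity Sg) (sym (ctrl-≡ v))) i

    field
      prnt-≡ : ∀ x → G.prnt (Sum.map ρv id x) ≡ Sum.map ρv id (B.prnt x)
      link-≡ : ∀ x → G.link (Sum.map id ρp x) ≡ Sum.map ρe id (B.link x)

data Sort : Set where
  node root site port o-name i-name e-name : Sort

data PlaceSrc (Name : Sort → Set) : Set where
  src-n : Name node → PlaceSrc Name
  src-s : Name site → PlaceSrc Name

data PlaceDst (Name : Sort → Set) : Set where
  dst-n : Name node → PlaceDst Name
  dst-r : Name root → PlaceDst Name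

data LinkSrc (Name : Sort → Set) : Set where
  src-i : Name i-name → LinkSrc Name
  src-p : Name port → LinkSrc Name

data LinkDst (Name : Sort → Set) : Set where
  dst-e : Name e-name → LinkDst Name
  dst-o : Name o-name → LinkDst Name

module _ {Name : Sort → Set} where

  placeSrc : Name node ⊎ Name site → PlaceSrc Name
  placeSrc = Sum.[ src-n , src-s ]

  placeDst : Name node ⊎ Name root → PlaceDst Name
  placeDst = Sum.[ dst-n , dst-r ]

  linkSrc : Name i-name ⊎ Name port → LinkSrc Name
  linkSrc = Sum.[ src-i , src-p ]

  linkDst : Name e-name ⊎ Name o-name → LinkDst Name
  linkDst = Sum.[ dst-e , dst-o ]

-- `is s` is the predicate is_s, for each of the seven sorts s.
data Fact (K : Set) (Name : Sort → Set) : Set where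
  is          : (s : Sort) → Name s → Fact K Name
  prnt        : PlaceSrc Name → PlaceDst Name → Fact K Name
  link        : LinkSrc Name → LinkDst Name → Fact K Name
  lc          : Name node → K → Fact K Name
  lp          : Name port → Name node → Fact K Name
  has-child-p : PlaceDst Name → ℕ → Fact K Name
  has-child-l : LinkDst Name → ℕ → Fact K Name

-- Multi-sets are lists considered up to permutation.
Facts : Signature → (Sort → Set) → Set
Facts Sg Name = List (Fact (Control Sg) Name)

-- |f⁻¹(b)|, where xs lists each element of the domain of f once.
preimageSize : {A B : Set} → DecidableEquality B → List A → (A → B) → B → ℕ
preimageSize _≟_ xs f b = length (filter (λ x → f x ≟ b) xs)

module _ {Sg : Signature} {I J : Interface} (B : Bigraph Sg I J) where
  private module B = Bigraph B

  Element : Sort → Set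
  Element node   = B.Node
  Element root   = Fin (width J)
  Element site   = Fin (width I)
  Element port   = B.Port
  Element o-name = LinkName J
  Element i-name = LinkName I
  Element e-name = B.Edge

  -- Names of different sorts are distinct because Name is indexed by sorts.
  Naming : (Sort → Set) → Set
  Naming Name = ∀ s → Element s ↣ Name s

  ports : List B.Port
  ports = concatMap (λ v → map (v ,_) (allFin (arity Sg (B.ctrl v)))) (elements B.nodes)

  children : B.Node ⊎ Fin (width J) → ℕ
  children = preimageSize (Sum.≡-dec (FiniteSet._≟_ B.nodes) Fin._≟_)
    (map inj₁ (elements B.nodes) ++ map inj₂ (allFin (width I))) B.prnt

  points : B.Edge ⊎ LinkName J → ℕ
  points = preimageSize (Sum.≡-dec (FiniteSet._≟_ B.edges) (FiniteSet._≟_ (names J)))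
    (map inj₁ (elements (names I)) ++ map inj₂ ports) B.link

  module Encoding {Name : Sort → Set} (ν : Naming Name) where

    name : ∀ s → Element s → Name s
    name s = Injection.to (ν s)

    parent : B.Node ⊎ Fin (width I) → PlaceDst Name
    parent x = placeDst (Sum.map (name node) (name root) (B.prnt x))

    target : LinkName I ⊎ B.Port → LinkDst Name
    target x = linkDst (Sum.map (name e-name) (name o-name) (B.link x))

    rootFacts : Fin (width J) → Facts Sg Name
    rootFacts r = is root (name root r)
      ∷ has-child-p (dst-r (name root r)) (children (inj₂ r)) ∷ []

    nodeFacts : B.Node → Facts Sg Name
    nodeFacts v = is node (name node v)
      ∷ lc (name node v) (B.ctrl v)
      ∷ has-child-p (dst-n (name node v)) (children (inj₁ v))
      ∷ prnt (src-n (name node v)) (parent (inj₁ v)) ∷ []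

    siteFacts : Fin (width I) → Facts Sg Name
    siteFacts s = is site (name site s)
      ∷ prnt (src-s (name site s)) (parent (inj₂ s)) ∷ []

    portFacts : B.Port → Facts Sg Name
    portFacts p@(v , _) = is port (name port p)
      ∷ lp (name port p) (name node v)
      ∷ link (src-p (name port p)) (target (inj₂ p)) ∷ []

    outerFacts : LinkName J → Facts Sg Name
    outerFacts o = is o-name (name o-name o)
      ∷ has-child-l (dst-o (name o-name o)) (points (inj₂ o)) ∷ []

    edgeFacts : B.Edge → Facts Sg Name
    edgeFacts e = is e-name (name e-name e)
      ∷ has-child-l (dst-e (name e-name e)) (points (inj₁ e)) ∷ []

    innerFacts : LinkName I → Facts Sg Name
    innerFacts x = is i-name (name i-name x)
      ∷ link (src-i (name i-name x)) (target (inj₁ x)) ∷ []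

    encoding : Facts Sg Name
    encoding = concatMap rootFacts (allFin (width J))
      ++ concatMap nodeFacts (elements B.nodes)
      ++ concatMap siteFacts (allFin (width I))
      ++ concatMap portFacts ports
      ++ concatMap outerFacts (elements (names J))
      ++ concatMap edgeFacts (elements B.edges)
      ++ concatMap innerFacts (elements (names I))

⟦_⟧ : ∀ {Sg I J Name} (B : Bigraph Sg I J) → Naming B Name → Facts Sg Name
⟦ B ⟧ ν = Encoding.encoding B ν

-- The elements that names may stand for.  No fact records the index of a port:
-- it comes from the pair (v , i) denoted by the port's name.
Denotable : (V E : Set) (I J : Interface) → Sort → Set
Denotable V E I J node   = V
Denotable V E I J root   = ℕ
Denotable V E I J site   = ℕ
Denotable V E I J port   = V × ℕ
Denotable V E I J o-name = LinkName J
Denotable V E I J i-name = LinkName I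
Denotable V E I J e-name = E

-- t ⇓ x means that |t| is defined and equal to x.
record Denotation (Name : Sort → Set) (V E : Set) (I J : Interface) : Set₁ where
  field
    _⇓_        : ∀ {s} → Name s → Denotable V E I J s → Set
    functional : ∀ {s} {t : Name s} {x y} → t ⇓ x → t ⇓ y → x ≡ y

module _ {Sg : Signature} {I J : Interface} (B : Bigraph Sg I J) where
  private module B = Bigraph B

  denotable : ∀ s → Element B s → Denotable B.Node B.Edge I J s
  denotable node   v       = v
  denotable root   r       = toℕ r
  denotable site   s       = toℕ s
  denotable port   (v , i) = v , toℕ i
  denotable o-name o       = o
  denotable i-name x       = x
  denotable e-name e       = e

  denotation : ∀ {Name} → Naming B Name → Denotation Name B.Node B.Edge I J
  denotation ν = record
    { _⇓_        = λ {s} t x → ∃ λ e → Injection.to (ν s) e ≡ t × denotable s e ≡ x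
    ; functional = λ { {s} (_ , p , refl) (_ , q , refl) →
        cong (denotable s) (Injection.injective (ν s) (trans p (sym q))) }
    }

module Reading (Sg : Signature) {Name : Sort → Set} {V E : Set} {I J : Interface}
               (δ : Denotation Name V E I J) (S : Facts Sg Name) where
  open Denotation δ

  Present : ∀ s → Denotable V E I J s → Set
  Present s x = ∃ λ t → t ⇓ x × is s t ∈ S

  HasControl : V → Control Sg → Set
  HasControl v k = ∃ λ t → t ⇓ v × lc t k ∈ S

  PortOf : V × ℕ → V → Set
  PortOf q v = ∃₂ λ p t → p ⇓ q × t ⇓ v × lp p t ∈ S

  Parent : V ⊎ ℕ → V ⊎ ℕ → Set
  Parent x y = ∃₂ λ a d → Pointwise _⇓_ _⇓_ a x × Pointwise _⇓_ _⇓_ d y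
    × prnt (placeSrc a) (placeDst d) ∈ S

  Link : LinkName I ⊎ (V × ℕ) → E ⊎ LinkName J → Set
  Link x y = ∃₂ λ a d → Pointwise _⇓_ _⇓_ a x × Pointwise _⇓_ _⇓_ d y
    × link (linkSrc a) (linkDst d) ∈ S

  Nodes Edges : Set
  Nodes = [ v ∈ V ∣ Present node v ]
  Edges = [ e ∈ E ∣ Present e-name e ]

  -- S encodes a bigraph with inner face I and outer face J: the names in S
  -- stand for elements, the denoted sites, roots, inner and outer names are
  -- exactly those of I and J, and the relations in S are graphs of total
  -- functions with the properties required of a bigraph.
  -- `∃!` says that the functions ctrl, prnt, link are given by "iff" clauses,
  -- e.g. ctrl* v ≡ k iff HasControl (value v) k.
  record EncodesBigraph : Set where
    field
      denoting : ∀ {s t} → is s t ∈ S → ∃ λ x → t ⇓ x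
      nodes    : ∃ λ k → Nodes ↔ Fin k
      edges    : ∃ λ k → Edges ↔ Fin k
      sites    : ∀ i → Present site i ⇔ i < width I
      roots    : ∀ i → Present root i ⇔ i < width J
      inner    : ∀ x → Present i-name x
      outer    : ∀ y → Present o-name y
      control  : ∀ (v : Nodes) → ∃! _≡_ (HasControl (value v))

    ctrl* : Nodes → Control Sg
    ctrl* v = proj₁ (control v)

    Port* : Set
    Port* = Σ[ v ∈ Nodes ] Fin (arity Sg (ctrl* v))

    place : ∀ {n} → Nodes ⊎ Fin n → V ⊎ ℕ
    place = Sum.map value toℕ

    point : LinkName I ⊎ Port* → LinkName I ⊎ (V × ℕ)
    point = Sum.map id λ (v , i) → value v , toℕ i

    handle : Edges ⊎ LinkName J → E ⊎ LinkName J
    handle = Sum.map value id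

    field
      owned  : ∀ q → Present port q → ∃ λ (v : Nodes) → PortOf q (value v)
      ports* : ∀ (v : Nodes) q → (Present port q × PortOf q (value v))
                 ⇔ (proj₁ q ≡ value v × proj₂ q < arity Sg (ctrl* v))
      parent : ∀ (x : Nodes ⊎ Fin (width I)) →
                 ∃! _≡_ λ (y : Nodes ⊎ Fin (width J)) → Parent (place x) (place y)
      linked : ∀ (x : LinkName I ⊎ Port*) →
                 ∃! _≡_ λ (y : Edges ⊎ LinkName J) → Link (point x) (handle y)

    prnt* : Nodes ⊎ Fin (width I) → Nodes ⊎ Fin (width J)
    prnt* x = proj₁ (parent x)

    link* : LinkName I ⊎ Port* → Edges ⊎ LinkName J
    link* x = proj₁ (linked x)

    field
      acyclic : Acyclic prnt*

  interpretation : EncodesBigraph → Bigraph Sg I J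
  interpretation enc = record
    { nodes   = record { Carrier = Nodes ; size = proj₁ nodes ; enum = proj₂ nodes }
    ; edges   = record { Carrier = Edges ; size = proj₁ edges ; enum = proj₂ edges }
    ; ctrl    = ctrl*
    ; prnt    = prnt*
    ; acyclic = acyclic
    ; link    = link*
    }
    where open EncodesBigraph enc

open Reading public using (EncodesBigraph)

⟦_⟧⋆ : ∀ {Sg Name V E I J} {δ : Denotation Name V E I J} (S : Facts Sg Name) →
       EncodesBigraph Sg δ S → Bigraph Sg I J
⟦_⟧⋆ {Sg} {δ = δ} S = Reading.interpretation Sg δ S

{-# OPTIONS --safe #-}
module Submission where

-- The proof rests on a single description of the encoding: a fact belongs to
-- the multi-set encoding a bigraph B exactly when it is true of B (`∈-encoding`), where
-- truth (`Holds`) asserts that the names in the fact are the names of elements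
-- of B standing in the stated relation.  Membership is invariant under
-- permutation, so the same holds of every S that is a permutation of it.
--
-- Since naming is injective, and so is the passage from an element of B to
-- what its name denotes, each relation read off from S is then the graph of
-- the corresponding map of B: `hasControl-⇔` for ctrl, `parent-⇔` for prnt,
-- `link-⇔` for link and `portOf-⇔` for the ownership of ports.  The nodes and
-- edges read off from S form the subset of B's nodes, resp. edges, given by a
-- predicate that always holds, so `value` is a bijection onto the latter.
--
-- Hence the relations are graphs of total functions, and a cycle of the parent
-- function read off from S would project to a cycle in B: S encodes a bigraph.
-- Moreover, for any proof that S encodes a bigraph, the functions that it
-- provides lie in those relations, so they agree with the maps of B along
-- `value`; the two copies of `value` are the required bijections.

open import Defs
open import Data.Product.Base using (_×_)
open import Data.List.Relation.Binary.Permutation.Propositional using (_↭_)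

open import Data.Fin.Base using (Fin; toℕ; fromℕ<; cast)
open import Data.Fin.Properties using (toℕ-injective; toℕ<n; toℕ-fromℕ<; toℕ-cast)
open import Data.Irrelevant using ([_])
open import Data.List.Base using (List; allFin; concatMap)
open import Data.List.Membership.Propositional using (_∈_; lose)
open import Data.List.Membership.Propositional.Properties
  using (∈-++⁺ˡ; ∈-++⁺ʳ; ∈-map⁺; ∈-concatMap⁺; ∈-tabulate⁺; ∈-allFin)
open import Data.List.Relation.Binary.Permutation.Propositional using (↭-sym)
open import Data.List.Relation.Binary.Permutation.Propositional.Properties using (∈-resp-↭)
open import Data.List.Relation.Unary.All as All using (All; []; _∷_)
import Data.List.Relation.Unary.All.Properties as All
open import Data.List.Relation.Unary.Any using (here; there)
open import Data.Nat.Base using (_<_)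
open import Data.Product using (∃; ∃₂; ∃!; _,_; proj₁; proj₂)
open import Data.Refinement using (Refinement-syntax; value; _,_)
open import Data.Sum.Base as Sum using (_⊎_; inj₁; inj₂)
open import Data.Sum.Function.Propositional using (_⊎-↔_)
open import Data.Sum.Relation.Binary.Pointwise using (Pointwise; inj₁; inj₂)
open import Function.Base using (id; _∘_)
open import Function.Bundles using (_⇔_; _↔_; mk⇔; mk↔ₛ′; Equivalence; Inverse)
open import Function.Construct.Identity using (↔-id)
open import Function.Properties.Inverse using (↔-trans; ↔⇒⤖)
open import Relation.Binary.Construct.Closure.Transitive using (TransClosure; [_]; _∷_)
open import Relation.Binary.PropositionalEquality
  using (_≡_; refl; sym; trans; cong; subst)

open FiniteSet using (Carrier; elements; enum)
open Signature
open Interface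

-- Lists, closures and subsets

∈-elements : (F : FiniteSet) (x : Carrier F) → x ∈ elements F
∈-elements F x = subst (_∈ elements F) (Inverse.strictlyInverseʳ (enum F) x)
  (∈-tabulate⁺ (Inverse.to (enum F) x))

∈-concatMap : {A B : Set} (f : A → List B) {xs : List A} {x : A} {y : B} →
              x ∈ xs → y ∈ f x → y ∈ concatMap f xs
∈-concatMap f x∈xs y∈fx = ∈-concatMap⁺ f (lose x∈xs y∈fx)

All-concatMap : {A B : Set} {P : B → Set} (f : A → List B) (xs : List A) →
                (∀ x → All P (f x)) → All P (concatMap f xs)
All-concatMap f xs Pf = All.concat⁺ (All.map⁺ (All.universal Pf xs))

TransClosure-map : {A B : Set} {R : A → A → Set} {T : B → B → Set} (f : A → B) →
                   (∀ {x y} → R x y → T (f x) (f y)) →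
                   ∀ {x y} → TransClosure R x y → TransClosure T (f x) (f y)
TransClosure-map f g [ r ]    = [ g r ]
TransClosure-map f g (r ∷ rs) = g r ∷ TransClosure-map f g rs

fullSubset-↔ : {A : Set} {P : A → Set} → (∀ x → P x) → [ x ∈ A ∣ P x ] ↔ A
fullSubset-↔ p = mk↔ₛ′ value (λ x → x , [ p x ]) (λ _ → refl) (λ _ → refl)

-- A relation that is transported by a bijection g to equality with c has
-- exactly one solution, the preimage of c.
∃!-along-↔ : {A C : Set} {P : A → Set} (g : A ↔ C) (c : C) →
             (∀ x → P x ⇔ c ≡ Inverse.to g x) → ∃! _≡_ P
∃!-along-↔ g c iff =
    Inverse.from g c
  , Equivalence.from (iff _) (sym (Inverse.strictlyInverseˡ g c))
  , λ p → trans (cong (Inverse.from g) (Equivalence.to (iff _) p))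
                (Inverse.strictlyInverseʳ g _)

-- Injectivity of the constructors for sources and destinations

module _ {Name : Sort → Set} where

  placeSrc-injective : ∀ x y → placeSrc {Name} x ≡ placeSrc y → x ≡ y
  placeSrc-injective (inj₁ _) (inj₁ _) refl = refl
  placeSrc-injective (inj₂ _) (inj₂ _) refl = refl

  placeDst-injective : ∀ x y → placeDst {Name} x ≡ placeDst y → x ≡ y
  placeDst-injective (inj₁ _) (inj₁ _) refl = refl
  placeDst-injective (inj₂ _) (inj₂ _) refl = refl

  linkSrc-injective : ∀ x y → linkSrc {Name} x ≡ linkSrc y → x ≡ y
  linkSrc-injective (inj₁ _) (inj₁ _) refl = refl
  linkSrc-injective (inj₂ _) (inj₂ _) refl = refl

  linkDst-injective : ∀ x y → linkDst {Name} x ≡ linkDst y → x ≡ y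
  linkDst-injective (inj₁ _) (inj₁ _) refl = refl
  linkDst-injective (inj₂ _) (inj₂ _) refl = refl

module _ {Sg : Signature} {I J : Interface} (B : Bigraph Sg I J)
         {Name : Sort → Set} (ν : Naming B Name) where

  private module B = Bigraph B
  open Encoding B ν
  open Denotation (denotation B ν)

  -- The facts of the encoding

  -- `Holds f` says that the fact f is true of B: its arguments name elements
  -- of B (or are controls or numbers) that stand in the relation asserted.
  -- It is a recursive function, so that it computes on the form of f.
  Holds : Fact (Control Sg) Name → Set
  Holds (is s t)          = ∃ λ x → name s x ≡ t
  Holds (prnt a d)        = ∃ λ x → placeSrc (Sum.map (name node) (name site) x) ≡ a × parent x ≡ d
  Holds (link a d)        = ∃ λ x → linkSrc (Sum.map (name i-name) (name port) x) ≡ a × target x ≡ d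
  Holds (lc t k)          = ∃ λ v → name node v ≡ t × B.ctrl v ≡ k
  Holds (lp t u)          = ∃ λ p → name port p ≡ t × name node (proj₁ p) ≡ u
  Holds (has-child-p d n) = ∃ λ x → placeDst (Sum.map (name node) (name root) x) ≡ d × children B x ≡ n
  Holds (has-child-l d n) = ∃ λ x → linkDst (Sum.map (name e-name) (name o-name) x) ≡ d × points B x ≡ n

  encoding-sound : All Holds encoding
  encoding-sound =
      All.++⁺ (All-concatMap rootFacts (allFin (width J)) λ r →
        (r , refl) ∷ (inj₂ r , refl , refl) ∷ [])
    ( All.++⁺ (All-concatMap nodeFacts (elements B.nodes) λ v →
        (v , refl) ∷ (v , refl , refl) ∷ (inj₁ v , refl , refl) ∷ (inj₁ v , refl , refl) ∷ [])
    ( All.++⁺ (All-concatMap siteFacts (allFin (width I)) λ s →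
        (s , refl) ∷ (inj₂ s , refl , refl) ∷ [])
    ( All.++⁺ (All-concatMap portFacts (ports B) λ p →
        (p , refl) ∷ (p , refl , refl) ∷ (inj₂ p , refl , refl) ∷ [])
    ( All.++⁺ (All-concatMap outerFacts (elements (names J)) λ o →
        (o , refl) ∷ (inj₂ o , refl , refl) ∷ [])
    ( All.++⁺ (All-concatMap edgeFacts (elements B.edges) λ e →
        (e , refl) ∷ (inj₁ e , refl , refl) ∷ [])
    ( All-concatMap innerFacts (elements (names I)) λ x →
        (x , refl) ∷ (inj₁ x , refl , refl) ∷ []))))))

  ∈-ports : ∀ p → p ∈ ports B
  ∈-ports (v , i) = ∈-concatMap _ (∈-elements B.nodes v) (∈-map⁺ (v ,_) (∈-allFin i))

  rootFacts⊆ : ∀ r {f} → f ∈ rootFacts r → f ∈ encoding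
  rootFacts⊆ r = ∈-++⁺ˡ ∘ ∈-concatMap rootFacts (∈-allFin r)

  nodeFacts⊆ : ∀ v {f} → f ∈ nodeFacts v → f ∈ encoding
  nodeFacts⊆ v = ∈-++⁺ʳ (concatMap rootFacts (allFin (width J)))
    ∘ ∈-++⁺ˡ ∘ ∈-concatMap nodeFacts (∈-elements B.nodes v)

  siteFacts⊆ : ∀ s {f} → f ∈ siteFacts s → f ∈ encoding
  siteFacts⊆ s = ∈-++⁺ʳ (concatMap rootFacts (allFin (width J)))
    ∘ ∈-++⁺ʳ (concatMap nodeFacts (elements B.nodes))
    ∘ ∈-++⁺ˡ ∘ ∈-concatMap siteFacts (∈-allFin s)

  portFacts⊆ : ∀ p {f} → f ∈ portFacts p → f ∈ encoding
  portFacts⊆ p = ∈-++⁺ʳ (concatMap rootFacts (allFin (width J)))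
    ∘ ∈-++⁺ʳ (concatMap nodeFacts (elements B.nodes))
    ∘ ∈-++⁺ʳ (concatMap siteFacts (allFin (width I)))
    ∘ ∈-++⁺ˡ ∘ ∈-concatMap portFacts (∈-ports p)

  outerFacts⊆ : ∀ o {f} → f ∈ outerFacts o → f ∈ encoding
  outerFacts⊆ o = ∈-++⁺ʳ (concatMap rootFacts (allFin (width J)))
    ∘ ∈-++⁺ʳ (concatMap nodeFacts (elements B.nodes))
    ∘ ∈-++⁺ʳ (concatMap siteFacts (allFin (width I)))
    ∘ ∈-++⁺ʳ (concatMap portFacts (ports B))
    ∘ ∈-++⁺ˡ ∘ ∈-concatMap outerFacts (∈-elements (names J) o)

  edgeFacts⊆ : ∀ e {f} → f ∈ edgeFacts e → f ∈ encoding
  edgeFacts⊆ e = ∈-++⁺ʳ (concatMap rootFacts (allFin (width J)))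
    ∘ ∈-++⁺ʳ (concatMap nodeFacts (elements B.nodes))
    ∘ ∈-++⁺ʳ (concatMap siteFacts (allFin (width I)))
    ∘ ∈-++⁺ʳ (concatMap portFacts (ports B))
    ∘ ∈-++⁺ʳ (concatMap outerFacts (elements (names J)))
    ∘ ∈-++⁺ˡ ∘ ∈-concatMap edgeFacts (∈-elements B.edges e)

  innerFacts⊆ : ∀ x {f} → f ∈ innerFacts x → f ∈ encoding
  innerFacts⊆ x = ∈-++⁺ʳ (concatMap rootFacts (allFin (width J)))
    ∘ ∈-++⁺ʳ (concatMap nodeFacts (elements B.nodes))
    ∘ ∈-++⁺ʳ (concatMap siteFacts (allFin (width I)))
    ∘ ∈-++⁺ʳ (concatMap portFacts (ports B))
    ∘ ∈-++⁺ʳ (concatMap outerFacts (elements (names J)))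
    ∘ ∈-++⁺ʳ (concatMap edgeFacts (elements B.edges))
    ∘ ∈-concatMap innerFacts (∈-elements (names I) x)

  encoding-complete : ∀ f → Holds f → f ∈ encoding
  encoding-complete (is node _)       (v , refl)             = nodeFacts⊆ v (here refl)
  encoding-complete (is root _)       (r , refl)             = rootFacts⊆ r (here refl)
  encoding-complete (is site _)       (s , refl)             = siteFacts⊆ s (here refl)
  encoding-complete (is port _)       (p , refl)             = portFacts⊆ p (here refl)
  encoding-complete (is o-name _)     (o , refl)             = outerFacts⊆ o (here refl)
  encoding-complete (is i-name _)     (x , refl)             = innerFacts⊆ x (here refl)
  encoding-complete (is e-name _)     (e , refl)             = edgeFacts⊆ e (here refl)
  encoding-complete (prnt _ _)        (inj₁ v , refl , refl) = nodeFacts⊆ v (there (there (there (here refl))))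
  encoding-complete (prnt _ _)        (inj₂ s , refl , refl) = siteFacts⊆ s (there (here refl))
  encoding-complete (link _ _)        (inj₁ x , refl , refl) = innerFacts⊆ x (there (here refl))
  encoding-complete (link _ _)        (inj₂ p , refl , refl) = portFacts⊆ p (there (there (here refl)))
  encoding-complete (lc _ _)          (v , refl , refl)      = nodeFacts⊆ v (there (here refl))
  encoding-complete (lp _ _)          (p , refl , refl)      = portFacts⊆ p (there (here refl))
  encoding-complete (has-child-p _ _) (inj₁ v , refl , refl) = nodeFacts⊆ v (there (there (here refl)))
  encoding-complete (has-child-p _ _) (inj₂ r , refl , refl) = rootFacts⊆ r (there (here refl))
  encoding-complete (has-child-l _ _) (inj₁ e , refl , refl) = edgeFacts⊆ e (there (here refl))
  encoding-complete (has-child-l _ _) (inj₂ o , refl , refl) = outerFacts⊆ o (there (here refl))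

  ∈-encoding : ∀ f → f ∈ encoding ⇔ Holds f
  ∈-encoding f = mk⇔ (All.lookup encoding-sound) (encoding-complete f)

  -- Names and what they denote

  denotable-injective : ∀ s {x y} → denotable B s x ≡ denotable B s y → x ≡ y
  denotable-injective node   eq = eq
  denotable-injective root   eq = toℕ-injective eq
  denotable-injective site   eq = toℕ-injective eq
  denotable-injective port {v , i} {w , j} eq with cong proj₁ eq
  ... | refl = cong (v ,_) (toℕ-injective (cong proj₂ eq))
  denotable-injective o-name eq = eq
  denotable-injective i-name eq = eq
  denotable-injective e-name eq = eq

  name-⇓ : ∀ s x → name s x ⇓ denotable B s x
  name-⇓ s x = x , refl , refl

  name-⇓-≡ : ∀ s x {y} → name s x ⇓ y → denotable B s x ≡ y
  name-⇓-≡ s x = functional (name-⇓ s x)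

  module _ (s t : Sort) where

    -- Naming, and what names denote, on elements of either of two sorts: the
    -- domains and codomains of prnt and link are sums of this form.
    name⊎ : Element B s ⊎ Element B t → Name s ⊎ Name t
    name⊎ = Sum.map (name s) (name t)

    denotable⊎ : Element B s ⊎ Element B t →
                 Denotable B.Node B.Edge I J s ⊎ Denotable B.Node B.Edge I J t
    denotable⊎ = Sum.map (denotable B s) (denotable B t)

    name⊎-⇓ : ∀ x → Pointwise _⇓_ _⇓_ (name⊎ x) (denotable⊎ x)
    name⊎-⇓ (inj₁ x) = inj₁ (name-⇓ s x)
    name⊎-⇓ (inj₂ x) = inj₂ (name-⇓ t x)

    name⊎-⇓-≡ : ∀ x y → Pointwise _⇓_ _⇓_ (name⊎ x) (denotable⊎ y) → x ≡ y
    name⊎-⇓-≡ (inj₁ x) (inj₁ y) (inj₁ p) = cong inj₁ (denotable-injective s (name-⇓-≡ s x p))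
    name⊎-⇓-≡ (inj₂ x) (inj₂ y) (inj₂ p) = cong inj₂ (denotable-injective t (name-⇓-≡ t x p))

  -- If a relation R between names is the image under naming of the graph of f,
  -- then the relation that R induces between denoted elements is the graph of
  -- f.  The place graph and the link graph are both instances.
  graph-⇔ : ∀ s t s′ t′ (f : Element B s ⊎ Element B t → Element B s′ ⊎ Element B t′)
            (R : Name s ⊎ Name t → Name s′ ⊎ Name t′ → Set) →
            (∀ a d → R a d ⇔ (∃ λ x → name⊎ s t x ≡ a × name⊎ s′ t′ (f x) ≡ d)) →
            ∀ x y → (∃₂ λ a d → Pointwise _⇓_ _⇓_ a (denotable⊎ s t x)
                              × Pointwise _⇓_ _⇓_ d (denotable⊎ s′ t′ y) × R a d)
                    ⇔ f x ≡ y
  graph-⇔ s t s′ t′ f R iff x y = mk⇔ to from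
    where
    Related : Set
    Related = ∃₂ λ a d → Pointwise _⇓_ _⇓_ a (denotable⊎ s t x)
                       × Pointwise _⇓_ _⇓_ d (denotable⊎ s′ t′ y) × R a d

    to : Related → f x ≡ y
    to (a , d , a⇓x , d⇓y , r) with Equivalence.to (iff a d) r
    ... | z , refl , refl with name⊎-⇓-≡ s t z x a⇓x
    ...   | refl = name⊎-⇓-≡ s′ t′ (f z) y d⇓y

    from : f x ≡ y → Related
    from refl = name⊎ s t x , name⊎ s′ t′ (f x) , name⊎-⇓ s t x , name⊎-⇓ s′ t′ (f x)
              , Equivalence.from (iff _ _) (x , refl , refl)

  -- The relations read off from the encoding

  module _ {S : Facts Sg Name} (S↭ : S ↭ encoding) where

    open Reading Sg (denotation B ν) S hiding (EncodesBigraph)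

    ∈-S : ∀ f → f ∈ S ⇔ Holds f
    ∈-S f = mk⇔ (Equivalence.to (∈-encoding f) ∘ ∈-resp-↭ S↭)
                (∈-resp-↭ (↭-sym S↭) ∘ Equivalence.from (∈-encoding f))

    holds : ∀ {f} → f ∈ S → Holds f
    holds = Equivalence.to (∈-S _)

    member : ∀ {f} → Holds f → f ∈ S
    member = Equivalence.from (∈-S _)

    denoting : ∀ {s t} → is s t ∈ S → ∃ λ x → t ⇓ x
    denoting {s} t∈ with holds t∈
    ... | x , refl = denotable B s x , name-⇓ s x

    present : ∀ s x → Present s (denotable B s x)
    present s x = name s x , name-⇓ s x , member (x , refl)

    present⁻ : ∀ s {q} → Present s q → ∃ λ x → denotable B s x ≡ q
    present⁻ s (t , t⇓q , t∈) with holds t∈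
    ... | x , refl = x , name-⇓-≡ s x t⇓q

    hasControl-⇔ : ∀ v k → HasControl v k ⇔ B.ctrl v ≡ k
    hasControl-⇔ v k = mk⇔ to λ { refl → name node v , name-⇓ node v , member (v , refl , refl) }
      where
      to : HasControl v k → B.ctrl v ≡ k
      to (t , t⇓v , t∈) with holds t∈
      ... | w , refl , refl = cong B.ctrl (sym (name-⇓-≡ node w t⇓v))

    -- An lp fact mentions only a port and its node; the bound on the index comes
    -- from what the name of the port denotes.
    portOf-⇔ : ∀ q v → PortOf q v ⇔ (proj₁ q ≡ v × proj₂ q < arity Sg (B.ctrl v))
    portOf-⇔ q v = mk⇔ to from
      where
      to : PortOf q v → proj₁ q ≡ v × proj₂ q < arity Sg (B.ctrl v)
      to (t , u , t⇓q , u⇓v , t∈) with holds t∈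
      ... | p , refl , refl with name-⇓-≡ port p t⇓q | name-⇓-≡ node (proj₁ p) u⇓v
      ...   | refl | refl = refl , toℕ<n (proj₂ p)

      from : proj₁ q ≡ v × proj₂ q < arity Sg (B.ctrl v) → PortOf q v
      from (refl , i<) = name port p , name node v
        , (p , refl , cong (v ,_) (toℕ-fromℕ< i<)) , name-⇓ node v , member (p , refl , refl)
        where
        p : B.Port
        p = v , fromℕ< i<

    parent-⇔ : ∀ x y → Parent (denotable⊎ node site x) (denotable⊎ node root y) ⇔ B.prnt x ≡ y
    parent-⇔ = graph-⇔ node site node root B.prnt _ λ a d → mk⇔ (to a d) from
      where
      to : ∀ a d → prnt (placeSrc a) (placeDst d) ∈ S →
           ∃ λ x → name⊎ node site x ≡ a × name⊎ node root (B.prnt x) ≡ d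
      to a d m with holds m
      ... | x , p , q = x , placeSrc-injective _ a p , placeDst-injective _ d q

      from : ∀ {a d} → (∃ λ x → name⊎ node site x ≡ a × name⊎ node root (B.prnt x) ≡ d) →
             prnt (placeSrc a) (placeDst d) ∈ S
      from (x , refl , refl) = member (x , refl , refl)

    link-⇔ : ∀ x y → Link (denotable⊎ i-name port x) (denotable⊎ e-name o-name y) ⇔ B.link x ≡ y
    link-⇔ = graph-⇔ i-name port e-name o-name B.link _ λ a d → mk⇔ (to a d) from
      where
      to : ∀ a d → link (linkSrc a) (linkDst d) ∈ S →
           ∃ λ x → name⊎ i-name port x ≡ a × name⊎ e-name o-name (B.link x) ≡ d
      to a d m with holds m
      ... | x , p , q = x , linkSrc-injective _ a p , linkDst-injective _ d q

      from : ∀ {a d} → (∃ λ x → name⊎ i-name port x ≡ a × name⊎ e-name o-name (B.link x) ≡ d) →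
             link (linkSrc a) (linkDst d) ∈ S
      from (x , refl , refl) = member (x , refl , refl)

    -- `parent-⇔` for the places read off from S, whose nodes are a subset of
    -- those of B.
    place-⇔ : (x : Nodes ⊎ Fin (width I)) (y : Nodes ⊎ Fin (width J)) →
              Parent (Sum.map value toℕ x) (Sum.map value toℕ y)
              ⇔ B.prnt (Sum.map value id x) ≡ Sum.map value id y
    place-⇔ (inj₁ _) (inj₁ _) = parent-⇔ _ _
    place-⇔ (inj₁ _) (inj₂ _) = parent-⇔ _ _
    place-⇔ (inj₂ _) (inj₁ _) = parent-⇔ _ _
    place-⇔ (inj₂ _) (inj₂ _) = parent-⇔ _ _

    -- `link-⇔` for the edges read off from S.
    handle-⇔ : ∀ x (y : Edges ⊎ LinkName J) →
               Link (denotable⊎ i-name port x) (Sum.map value id y) ⇔ B.link x ≡ Sum.map value id y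
    handle-⇔ x (inj₁ _) = link-⇔ _ _
    handle-⇔ x (inj₂ _) = link-⇔ _ _

    -- The encoding encodes a bigraph, which is the original one

    nodes-↔ : Nodes ↔ B.Node
    nodes-↔ = fullSubset-↔ (present node)

    edges-↔ : Edges ↔ B.Edge
    edges-↔ = fullSubset-↔ (present e-name)

    sites-⇔ : ∀ i → Present site i ⇔ i < width I
    sites-⇔ i = mk⇔ to λ i< → subst (Present site) (toℕ-fromℕ< i<) (present site (fromℕ< i<))
      where
      to : Present site i → i < width I
      to p with present⁻ site p
      ... | x , refl = toℕ<n x

    roots-⇔ : ∀ i → Present root i ⇔ i < width J
    roots-⇔ i = mk⇔ to λ i< → subst (Present root) (toℕ-fromℕ< i<) (present root (fromℕ< i<))
      where
      to : Present root i → i < width J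
      to p with present⁻ root p
      ... | x , refl = toℕ<n x

    ports-⇔ : ∀ v q → (Present port q × PortOf q v)
                      ⇔ (proj₁ q ≡ v × proj₂ q < arity Sg (B.ctrl v))
    ports-⇔ v q = mk⇔ (Equivalence.to (portOf-⇔ q v) ∘ proj₂)
                      λ r → presentPort r , Equivalence.from (portOf-⇔ q v) r
      where
      presentPort : proj₁ q ≡ v × proj₂ q < arity Sg (B.ctrl v) → Present port q
      presentPort (refl , i<) =
        subst (Present port) (cong (v ,_) (toℕ-fromℕ< i<)) (present port (v , fromℕ< i<))

    owner : ∀ q → Present port q → ∃ λ (v : Nodes) → PortOf q (value v)
    owner q p with present⁻ port p
    ... | (v , i) , refl = Inverse.from nodes-↔ v , Equivalence.from (portOf-⇔ _ v) (refl , toℕ<n i)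

    -- The parent function read off from S is that of B, conjugated by `value`;
    -- likewise `links` for the link function.
    parents : (x : Nodes ⊎ Fin (width I)) →
              ∃! _≡_ λ (y : Nodes ⊎ Fin (width J)) → Parent (Sum.map value toℕ x) (Sum.map value toℕ y)
    parents x = ∃!-along-↔ (nodes-↔ ⊎-↔ ↔-id _) (B.prnt (Sum.map value id x)) (place-⇔ x)

    parents-acyclic : Acyclic (proj₁ ∘ parents)
    parents-acyclic v cycle = B.acyclic (value v) (TransClosure-map value (λ {u} {w} → step u w) cycle)
      where
      step : ∀ u w → proj₁ (parents (inj₁ u)) ≡ inj₁ w → B.prnt (inj₁ (value u)) ≡ inj₁ (value w)
      step u _ eq = trans
        (Equivalence.to (place-⇔ (inj₁ u) (proj₁ (parents (inj₁ u)))) (proj₁ (proj₂ (parents (inj₁ u)))))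
        (cong (Sum.map value id) eq)

    links : (x : LinkName I ⊎ ∃ λ (v : Nodes) → Fin (arity Sg (B.ctrl (value v)))) →
            ∃! _≡_ λ (y : Edges ⊎ LinkName J) →
              Link (Sum.map id (λ (v , i) → value v , toℕ i) x) (Sum.map value id y)
    links (inj₁ x)       = ∃!-along-↔ (edges-↔ ⊎-↔ ↔-id _) _ (handle-⇔ (inj₁ x))
    links (inj₂ (v , i)) = ∃!-along-↔ (edges-↔ ⊎-↔ ↔-id _) _ (handle-⇔ (inj₂ (value v , i)))

    encodesBigraph : EncodesBigraph Sg (denotation B ν) S
    encodesBigraph = record
      { denoting = denoting
      ; nodes    = _ , ↔-trans nodes-↔ (enum B.nodes)
      ; edges    = _ , ↔-trans edges-↔ (enum B.edges)
      ; sites    = sites-⇔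
      ; roots    = roots-⇔
      ; inner    = present i-name
      ; outer    = present o-name
      ; control  = λ v → ∃!-along-↔ (↔-id _) (B.ctrl (value v)) (hasControl-⇔ (value v))
      ; owned    = owner
      ; ports*   = λ v → ports-⇔ (value v)
      ; parent   = parents
      ; linked   = links
      ; acyclic  = parents-acyclic
      }

    -- The witness enc is arbitrary: its functions agree with those of B only
    -- because their values satisfy the relations read off from S.
    interpretation-≎ : (enc : EncodesBigraph Sg (denotation B ν) S) → interpretation enc ≎ B
    interpretation-≎ enc = record
      { ρV     = ↔⇒⤖ nodes-↔
      ; ρE     = ↔⇒⤖ edges-↔
      ; ctrl-≡ = ctrl*-≡
      ; prnt-≡ = λ x → Equivalence.to (place-⇔ x (enc.prnt* x)) (proj₁ (proj₂ (enc.parent x)))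
      ; link-≡ = link*-≡
      }
      where
      module enc = EncodesBigraph enc
      open enc using (ctrl*; link*; control; linked; Port*; point; handle)

      ctrl*-≡ : ∀ v → B.ctrl (value v) ≡ ctrl* v
      ctrl*-≡ v = Equivalence.to (hasControl-⇔ (value v) _) (proj₁ (proj₂ (control v)))

      -- The bijection on ports induced by `value`.
      toPort : Port* → B.Port
      toPort (v , i) = value v , cast (cong (arity Sg) (sym (ctrl*-≡ v))) i

      -- The cast along the equality of controls keeps the index of the port.
      point-≡ : ∀ x → point x ≡ denotable⊎ i-name port (Sum.map id toPort x)
      point-≡ (inj₁ x)       = refl
      point-≡ (inj₂ (v , i)) = cong (λ j → inj₂ (value v , j)) (sym (toℕ-cast _ i))

      link*-≡ : ∀ x → B.link (Sum.map id toPort x) ≡ Sum.map value id (link* x)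
      link*-≡ x = Equivalence.to (handle-⇔ _ (link* x))
        (subst (λ q → Link q (handle (link* x))) (point-≡ x) (proj₁ (proj₂ (linked x))))

theorem2 : (Sg : Signature) (I J : Interface) (B : Bigraph Sg I J)
    (Name : Sort → Set) (ν : Naming B Name)
    (S : Facts Sg Name) → S ↭ ⟦ B ⟧ ν →
    EncodesBigraph Sg (denotation B ν) S ×
    ((enc : EncodesBigraph Sg (denotation B ν) S) → ⟦ S ⟧⋆ enc ≎ B)
theorem2 Sg I J B Name ν S S↭ = encodesBigraph B ν S↭ , interpretation-≎ B ν S↭
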